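{- For every formula $\varphi\in\mathrm{For}(\Sigma)$: if $\nvdash_{\mathrm{RmbC}}\varphi$, then there exist a finite BALFI $\mathbf{A}$ and a valuation $v:\mathrm{For}(\Sigma)\to A$ such that $v(\varphi)\neq 1$.
   Context: $\mathrm{For}(\Sigma)$ is the set of formulas built from a countably infinite set of propositional variables using the signature $\Sigma$: binary $\wedge,\vee,\to$ and unary $\neg,\circ$; $\alpha\leftrightarrow\beta$ abbreviates $(\alpha\to\beta)\wedge(\beta\to\alpha)$. The logic $\mathrm{RmbC}$ is given by the Hilbert calculus with axiom schemas $\alpha\to(\beta\to\alpha)$; $(\alpha\to(\beta\to\gamma))\to((\alpha\to\beta)\to(\alpha\to\gamma))$; $\alpha\to(\beta\to(\alpha\wedge\beta))$; $(\alpha\wedge\beta)\to\alpha$; $(\alpha\wedge\beta)\to\beta$; $\alpha\to(\alpha\vee\beta)$; $\beta\to(\alpha\vee\beta)$; $(\alpha\to\gamma)\to((\beta\to\gamma)\to((\alpha\vee\beta)\to\gamma))$; $(\alpha\to\beta)\vee\alpha$; $\alpha\vee\neg\alpha$; $\circ\alpha\to(\alpha\to(\neg\alpha\to\beta))$; and inference rules: modus ponens (from $\alpha$ and $\alpha\to\beta$ infer $\beta$); $(R_\neg)$: from $\alpha\leftrightarrow\psi$ infer $\neg\alpha\leftrightarrow\neg\psi$; $(R_\circ)$: from $\alpha\leftrightarrow\psi$ infer $\circ\alpha\leftrightarrow\circ\psi$. $\vdash_{\mathrm{RmbC}}\varphi$ means $\varphi$ is derivable in this calculus (without premises). A BALFI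 is an algebra $\mathbf{B}=\langle B,\wedge,\vee,\to,\neg,\circ,0,1\rangle$ such that $\langle B,\wedge,\vee,\to,0,1\rangle$ is a Boolean algebra and, for every $a\in B$, $a\vee\neg a=1$ and $a\wedge\neg a\wedge\circ a=0$. A valuation over $\mathbf{B}$ is a homomorphism $v:\mathrm{For}(\Sigma)\to B$ with respect to $\wedge,\vee,\to,\neg,\circ$. -}

module Defs where

open import Algebra.Core using (Op₁; Op₂)
open import Algebra.Lattice.Structures using (IsBooleanAlgebra)
open import Data.Fin using (Fin)
open import Data.Nat using (ℕ)
open import Data.Product using (∃-syntax)
open import Function.Bundles using (_↔_)
open import Relation.Binary.PropositionalEquality using (_≡_)

infix  8 ∼_ ○_
infixr 7 _∧_
infixr 6 _∨_
infixr 5 _⇒_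
infix  4 _⇔_
infix  3 ⊢_

-- ∼ is the paraconsistent negation and ○ the consistency operator.
data Formula : Set where
  var         : ℕ → Formula
  _∧_ _∨_ _⇒_ : Formula → Formula → Formula
  ∼_ ○_       : Formula → Formula

_⇔_ : Formula → Formula → Formula
α ⇔ β = (α ⇒ β) ∧ (β ⇒ α)

-- Derivability in RmbC without premises, so the replacement rules are
-- applied to theorems only.
data ⊢_ : Formula → Set where
  K        : ∀ α β → ⊢ (α ⇒ (β ⇒ α))
  S        : ∀ α β γ → ⊢ ((α ⇒ (β ⇒ γ)) ⇒ ((α ⇒ β) ⇒ (α ⇒ γ)))
  ∧-intro  : ∀ α β → ⊢ (α ⇒ (β ⇒ (α ∧ β)))
  ∧-elimˡ  : ∀ α β → ⊢ ((α ∧ β) ⇒ α)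
  ∧-elimʳ  : ∀ α β → ⊢ ((α ∧ β) ⇒ β)
  ∨-introˡ : ∀ α β → ⊢ (α ⇒ (α ∨ β))
  ∨-introʳ : ∀ α β → ⊢ (β ⇒ (α ∨ β))
  ∨-elim   : ∀ α β γ → ⊢ ((α ⇒ γ) ⇒ ((β ⇒ γ) ⇒ ((α ∨ β) ⇒ γ)))
  ⇒-or     : ∀ α β → ⊢ ((α ⇒ β) ∨ α)
  ∼-em     : ∀ α → ⊢ (α ∨ (∼ α))
  ○-expl   : ∀ α β → ⊢ ((○ α) ⇒ (α ⇒ ((∼ α) ⇒ β)))
  MP       : ∀ {α β} → ⊢ α → ⊢ (α ⇒ β) → ⊢ β
  R∼       : ∀ {α β} → ⊢ (α ⇔ β) → ⊢ ((∼ α) ⇔ (∼ β))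
  R○       : ∀ {α β} → ⊢ (α ⇔ β) → ⊢ ((○ α) ⇔ (○ β))

record BALFI : Set₁ where
  infixr 7 _⊓_
  infixr 6 _⊔_
  infixr 5 _⇨_
  field
    Carrier : Set
    _⊓_     : Op₂ Carrier
    _⊔_     : Op₂ Carrier
    _⇨_     : Op₂ Carrier
    neg     : Op₁ Carrier
    circ    : Op₁ Carrier
    0#      : Carrier
    1#      : Carrier

    -- The signature has no Boolean complement: it is the term a ⇨ 0#,
    -- in general different from neg a.  The second law says that ⇨ is the
    -- Boolean implication.
    isBooleanAlgebra : IsBooleanAlgebra _≡_ _⊔_ _⊓_ (λ a → a ⇨ 0#) 1# 0#
    ⇨-def            : ∀ a b → (a ⇨ b) ≡ ((a ⇨ 0#) ⊔ b)

    neg-em    : ∀ a → (a ⊔ neg a) ≡ 1#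
    circ-expl : ∀ a → ((a ⊓ neg a) ⊓ circ a) ≡ 0#

IsFinite : BALFI → Set
IsFinite A = ∃[ n ] (BALFI.Carrier A ↔ Fin n)

record IsValuation (A : BALFI) (v : Formula → BALFI.Carrier A) : Set where
  open BALFI A
  field
    ∧-homo : ∀ α β → v (α ∧ β) ≡ (v α ⊓ v β)
    ∨-homo : ∀ α β → v (α ∨ β) ≡ (v α ⊔ v β)
    ⇒-homo : ∀ α β → v (α ⇒ β) ≡ (v α ⇨ v β)
    ∼-homo : ∀ α → v (∼ α) ≡ neg (v α)
    ○-homo : ∀ α → v (○ α) ≡ circ (v α)

{-# OPTIONS --safe #-}

-- The proof is a filtration that is effective, as needed to extract a model
-- from the mere negation of derivability.  A state is a Boolean assignment to
-- the atoms of φ: its variables and, for each subformula ∼ α or ○ α, both ∼ α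
-- and ○ α.  A list of states is exhaustive when whatever follows from every
-- state in it is a theorem.  The list of all states is exhaustive, and remains
-- so when a state is removed that refutes itself.  This happens if the state
-- violates excluded middle or gentle explosion, or if it separates ∼ α from
-- ∼ β (or ○ α from ○ β) although α and β hold at the same listed states: then
-- α ⇔ β is a theorem by exhaustiveness, and R∼ and R○ apply.  When nothing can
-- be removed, the subsets of the list form the required BALFI.

module Submission where

open import Defs
open import Algebra.Lattice.Structures using (IsBooleanAlgebra)
open import Data.Bool.Base as 𝔹 using (Bool; true; false; not)
import Data.Bool.Properties as 𝔹
open import Data.Fin using (Fin)
open import Data.Fin.Properties using (*↔×; 1↔⊤; 2↔Bool)
open import Data.Fin.Subset using (Subset; ⊤; ⊥; _∪_; _∩_; ∁)
open import Data.Fin.Subset.Properties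
  using (∪-∩-isBooleanAlgebra; ∪-identityʳ; ∩-zeroʳ; ∪-zeroʳ)
open import Data.List.Base using (List; []; _∷_; _++_; length; map)
open import Data.List.Membership.Propositional using (_∈_; find; lose)
open import Data.List.Membership.Propositional.Properties using (∈-++⁻)
open import Data.List.Relation.Binary.Subset.Propositional using (_⊆_)
open import Data.List.Relation.Binary.Subset.Propositional.Properties
  using (xs⊆xs++ys; xs⊆ys++xs; xs⊆x∷xs)
open import Data.List.Relation.Unary.All as All using (All; []; _∷_)
import Data.List.Relation.Unary.All.Properties as All
open import Data.List.Relation.Unary.Any using (Any; here; there; any?)
import Data.List.Membership.DecPropositional as DecMembership
open import Data.Maybe.Base using (Maybe; just; nothing)
open import Data.Nat using (zero; suc; _^_; _<_; s≤s)
import Data.Nat.Properties as ℕ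
open import Data.Nat.Induction using (<-wellFounded)
open import Data.Product using (Σ-syntax; ∃-syntax; _×_; _,_; proj₁; proj₂; uncurry)
open import Data.Product.Function.NonDependent.Propositional using (_×-↔_)
open import Data.Sum using (_⊎_; inj₁; inj₂; [_,_]′)
import Data.Sum as Sum
open import Data.Vec.Base as Vec using ([]; _∷_; fromList)
import Data.Vec.Properties as Vec
open import Function.Base using (_∘_; const; id)
open import Function.Bundles using (_↔_; mk↔ₛ′)
open import Function.Properties.Inverse using (↔-sym; ↔-trans)
open import Induction.WellFounded using (Acc; acc)
open import Relation.Binary.Definitions using (DecidableEquality)
open import Relation.Binary.PropositionalEquality
  using (_≡_; _≢_; refl; sym; trans; cong; cong₂; subst)
open import Relation.Nullary using (¬_; Dec; yes; no; contradiction)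

-- Decidable equality of formulas.

equal? : (α β : Formula) → Maybe (α ≡ β)
equal? (var m) (var n) with m ℕ.≟ n
... | yes refl = just refl
... | no  _    = nothing
equal? (α ∧ β) (γ ∧ δ) with equal? α γ | equal? β δ
... | just refl | just refl = just refl
... | _         | _         = nothing
equal? (α ∨ β) (γ ∨ δ) with equal? α γ | equal? β δ
... | just refl | just refl = just refl
... | _         | _         = nothing
equal? (α ⇒ β) (γ ⇒ δ) with equal? α γ | equal? β δ
... | just refl | just refl = just refl
... | _         | _         = nothing
equal? (∼ α) (∼ β) with equal? α β
... | just refl = just refl
... | nothing   = nothing
equal? (○ α) (○ β) with equal? α β
... | just refl = just refl
... | nothing   = nothing
equal? _ _ = nothing

-- Lets `_≟_` refute equality from `nothing`, so one catch-all clause of `equal?` covers all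
-- mismatched constructors.
equal?-refl : ∀ α → equal? α α ≡ just refl
equal?-refl (var n) rewrite ℕ.≟-diag (refl {x = n}) = refl
equal?-refl (α ∧ β) rewrite equal?-refl α | equal?-refl β = refl
equal?-refl (α ∨ β) rewrite equal?-refl α | equal?-refl β = refl
equal?-refl (α ⇒ β) rewrite equal?-refl α | equal?-refl β = refl
equal?-refl (∼ α)   rewrite equal?-refl α = refl
equal?-refl (○ α)   rewrite equal?-refl α = refl

_≟_ : DecidableEquality Formula
α ≟ β with equal? α β in eq
... | just α≡β = yes α≡β
... | nothing  = no λ { refl → contradiction (trans (sym eq) (equal?-refl α)) λ () }

open DecMembership _≟_ using (_∈?_)

-- Derivations from hypotheses.

infix 3 _⊩_

-- `R∼` and `R○` enter only through `thm`, hence never act on hypotheses; this keeps the deduction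
-- theorem true.
data _⊩_ (Δ : List Formula) : Formula → Set where
  hyp : ∀ {α} → α ∈ Δ → Δ ⊩ α
  thm : ∀ {α} → ⊢ α → Δ ⊩ α
  mp  : ∀ {α β} → Δ ⊩ α → Δ ⊩ α ⇒ β → Δ ⊩ β

weaken : ∀ {Δ Δ′ α} → Δ ⊆ Δ′ → Δ ⊩ α → Δ′ ⊩ α
weaken s (hyp p)  = hyp (s p)
weaken s (thm d)  = thm d
weaken s (mp d e) = mp (weaken s d) (weaken s e)

closed : ∀ {α} → [] ⊩ α → ⊢ α
closed (thm d)  = d
closed (mp d e) = MP (closed d) (closed e)

constant : ∀ {Δ α β} → Δ ⊩ β → Δ ⊩ α ⇒ β
constant d = mp d (thm (K _ _))

deduction : ∀ {Δ α β} → α ∷ Δ ⊩ β → Δ ⊩ α ⇒ β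
deduction {α = α} (hyp (here refl)) = mp (thm (K α α)) (mp (thm (K α (α ⇒ α))) (thm (S _ _ _)))
deduction (hyp (there p)) = constant (hyp p)
deduction (thm d)         = constant (thm d)
deduction (mp d e)        = mp (deduction d) (mp (deduction e) (thm (S _ _ _)))

compose : ∀ {Δ α β γ} → Δ ⊩ α ⇒ β → Δ ⊩ β ⇒ γ → Δ ⊩ α ⇒ γ
compose d e = mp d (mp (constant e) (thm (S _ _ _)))

pair : ∀ {Δ α β} → Δ ⊩ α → Δ ⊩ β → Δ ⊩ α ∧ β
pair d e = mp e (mp d (thm (∧-intro _ _)))

case : ∀ {Δ α β γ} → Δ ⊩ α ∨ β → Δ ⊩ α ⇒ γ → Δ ⊩ β ⇒ γ → Δ ⊩ γ
case c d e = mp c (mp e (mp d (thm (∨-elim _ _ _))))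

-- Falsum, literals and truth tables.

-- RmbC has no falsum; any contradiction with a consistency assertion serves.
falsum : Formula
falsum = (○ var 0) ∧ (var 0 ∧ (∼ var 0))

ex-falso : ∀ {Δ} α → Δ ⊩ falsum ⇒ α
ex-falso α = deduction
  (mp (mp p (thm (∧-elimʳ _ _))) (mp (mp p (thm (∧-elimˡ _ _)))
    (mp (mp f (thm (∧-elimˡ _ _))) (thm (○-expl _ α)))))
  where
  f = hyp (here refl)
  p = mp f (thm (∧-elimʳ _ _))

literal : Formula → Bool → Formula
literal α true  = α
literal α false = α ⇒ falsum

-- The axiom `(α ⇒ β) ∨ α` at `falsum` makes the false literal a classical negation, which `∼ α`
-- need not be.
literal-cases : ∀ {Δ α χ} → literal α true ∷ Δ ⊩ χ → literal α false ∷ Δ ⊩ χ → Δ ⊩ χ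
literal-cases d e = case (thm (⇒-or _ falsum)) (deduction e) (deduction d)

literal-∧ : ∀ {Δ α β} a b → Δ ⊩ literal α a → Δ ⊩ literal β b → Δ ⊩ literal (α ∧ β) (a 𝔹.∧ b)
literal-∧ true  true  d e = pair d e
literal-∧ true  false d e = compose (thm (∧-elimʳ _ _)) e
literal-∧ false _     d e = compose (thm (∧-elimˡ _ _)) d

literal-∨ : ∀ {Δ α β} a b → Δ ⊩ literal α a → Δ ⊩ literal β b → Δ ⊩ literal (α ∨ β) (a 𝔹.∨ b)
literal-∨ true  _     d e = mp d (thm (∨-introˡ _ _))
literal-∨ false true  d e = mp e (thm (∨-introʳ _ _))
literal-∨ false false d e = mp e (mp d (thm (∨-elim _ _ _)))

literal-⇒ : ∀ {Δ α β} a b → Δ ⊩ literal α a → Δ ⊩ literal β b → Δ ⊩ literal (α ⇒ β) (not a 𝔹.∨ b)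
literal-⇒ false _     d e = compose d (ex-falso _)
literal-⇒ true  true  d e = constant e
literal-⇒ true  false d e =
  deduction (mp (mp (weaken (xs⊆x∷xs _ _) d) (hyp (here refl))) (weaken (xs⊆x∷xs _ _) e))

literal-⇔ : ∀ {Δ α β} b → Δ ⊩ literal α b → Δ ⊩ literal β b → Δ ⊩ α ⇔ β
literal-⇔ true  d e = pair (constant e) (constant d)
literal-⇔ false d e = pair (compose d (ex-falso _)) (compose e (ex-falso _))

-- Meant for equivalences obtained by `R∼` and `R○`: a state that separates their two sides refutes
-- itself.
agree? : ∀ {Δ α β} a b → ⊢ α ⇔ β → Δ ⊩ literal α a → Δ ⊩ literal β b → a ≡ b ⊎ Δ ⊩ falsum
agree? true  true  _   d e = inj₁ refl
agree? false false _   d e = inj₁ refl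
agree? true  false α⇔β d e = inj₂ (mp (mp d (thm (MP α⇔β (∧-elimˡ _ _)))) e)
agree? false true  α⇔β d e = inj₂ (mp (mp e (thm (MP α⇔β (∧-elimʳ _ _)))) d)

-- The rows with α and `∼ α` both false contradict `∼-em`, and the row with α, `∼ α` and `○ α` all
-- true contradicts `○-expl`.
balanced? : ∀ {Δ α} a n c → Δ ⊩ literal α a → Δ ⊩ literal (∼ α) n → Δ ⊩ literal (○ α) c →
            ((a 𝔹.∨ n ≡ true) × ((a 𝔹.∧ n) 𝔹.∧ c ≡ false)) ⊎ Δ ⊩ falsum
balanced? false false _     d e f = inj₂ (case (thm (∼-em _)) d e)
balanced? false true  _     d e f = inj₁ (refl , refl)
balanced? true  false _     d e f = inj₁ (refl , refl)
balanced? true  true  false d e f = inj₁ (refl , refl)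
balanced? true  true  true  d e f = inj₂ (mp e (mp d (mp f (thm (○-expl _ _)))))

-- Atoms and evaluation.

-- Both ∼ α and ○ α are listed when either occurs, so that the algebra can
-- choose neg and circ at the truth set of α simultaneously.
atoms : Formula → List Formula
atoms (var n) = var n ∷ []
atoms (α ∧ β) = atoms α ++ atoms β
atoms (α ∨ β) = atoms α ++ atoms β
atoms (α ⇒ β) = atoms α ++ atoms β
atoms (∼ α)   = (∼ α) ∷ (○ α) ∷ atoms α
atoms (○ α)   = (∼ α) ∷ (○ α) ∷ atoms α

-- To evaluate φ in the model, `neg` and `circ` are applied only at the truth sets of these
-- formulas.
arguments : Formula → List Formula
arguments (var n) = []
arguments (α ∧ β) = arguments α ++ arguments β
arguments (α ∨ β) = arguments α ++ arguments β
arguments (α ⇒ β) = arguments α ++ arguments β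
arguments (∼ α)   = α ∷ arguments α
arguments (○ α)   = α ∷ arguments α

-- Ensures that a state for φ decides α, `∼ α` and `○ α` together.
atoms-argument : ∀ {α} φ → α ∈ arguments φ → atoms (∼ α) ⊆ atoms φ
atoms-argument (φ ∧ ψ) p =
  [ (λ q → xs⊆xs++ys _ _ ∘ atoms-argument φ q)
  , (λ q → xs⊆ys++xs _ (atoms φ) ∘ atoms-argument ψ q) ]′ (∈-++⁻ (arguments φ) p)
atoms-argument (φ ∨ ψ) p =
  [ (λ q → xs⊆xs++ys _ _ ∘ atoms-argument φ q)
  , (λ q → xs⊆ys++xs _ (atoms φ) ∘ atoms-argument ψ q) ]′ (∈-++⁻ (arguments φ) p)
atoms-argument (φ ⇒ ψ) p =
  [ (λ q → xs⊆xs++ys _ _ ∘ atoms-argument φ q)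
  , (λ q → xs⊆ys++xs _ (atoms φ) ∘ atoms-argument ψ q) ]′ (∈-++⁻ (arguments φ) p)
atoms-argument (∼ φ) (here refl) = id
atoms-argument (∼ φ) (there p)   = there ∘ there ∘ atoms-argument φ p
atoms-argument (○ φ) (here refl) = id
atoms-argument (○ φ) (there p)   = there ∘ there ∘ atoms-argument φ p

evaluate : (Formula → Bool) → Formula → Bool
evaluate r (α ∧ β) = evaluate r α 𝔹.∧ evaluate r β
evaluate r (α ∨ β) = evaluate r α 𝔹.∨ evaluate r β
evaluate r (α ⇒ β) = not (evaluate r α) 𝔹.∨ evaluate r β
-- `∼ α` and `○ α` are treated as atoms, since the value of α does not determine theirs.
evaluate r α       = r α

-- Kalmár's lemma, by induction on φ with the truth tables above.
evaluate-literal : ∀ {Δ r} φ → (∀ {α} → α ∈ atoms φ → Δ ⊩ literal α (r α)) →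
                   Δ ⊩ literal φ (evaluate r φ)
evaluate-literal (var n) h = h (here refl)
evaluate-literal (α ∧ β) h = literal-∧ _ _
  (evaluate-literal α (h ∘ xs⊆xs++ys _ _)) (evaluate-literal β (h ∘ xs⊆ys++xs _ (atoms α)))
evaluate-literal (α ∨ β) h = literal-∨ _ _
  (evaluate-literal α (h ∘ xs⊆xs++ys _ _)) (evaluate-literal β (h ∘ xs⊆ys++xs _ (atoms α)))
evaluate-literal (α ⇒ β) h = literal-⇒ _ _
  (evaluate-literal α (h ∘ xs⊆xs++ys _ _)) (evaluate-literal β (h ∘ xs⊆ys++xs _ (atoms α)))
evaluate-literal (∼ α)   h = h (here refl)
evaluate-literal (○ α)   h = h (there (here refl))

-- States and exhaustive lists.

-- An atom listed twice may receive two values; evaluation uses one of them,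
-- and such a state does no harm as its literals are contradictory.
State : List Formula → Set
State = All (const Bool)

states : ∀ as → List (State as)
states []       = [] ∷ []
states (a ∷ as) = map (true ∷_) (states as) ++ map (false ∷_) (states as)

literals : ∀ {as} → State as → List Formula
literals []                = []
literals (_∷_ {x = a} b w) = literal a b ∷ literals w

lookup-literal : ∀ {as a} (w : State as) (p : a ∈ as) → literal a (All.lookup w p) ∈ literals w
lookup-literal (b ∷ w) (here refl) = here refl
lookup-literal (b ∷ w) (there p)   = there (lookup-literal w p)

value : ∀ {as} → State as → Formula → Bool
value {as} w a with a ∈? as
... | yes p = All.lookup w p
-- An arbitrary default; `value-literal` speaks only of listed atoms.
... | no  _ = false

value-literal : ∀ {as a} (w : State as) → a ∈ as → literals w ⊩ literal a (value w a)
value-literal {as} {a} w p with a ∈? as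
... | yes q  = hyp (lookup-literal w q)
... | no a∉as = contradiction p a∉as

holds : ∀ {as} → Formula → State as → Bool
holds φ w = evaluate (value w) φ

holds-literal : ∀ {as} φ → atoms φ ⊆ as → (w : State as) → literals w ⊩ literal φ (holds φ w)
holds-literal φ s w = evaluate-literal φ (value-literal w ∘ s)

Exhaustive : ∀ {as} → List (State as) → Set
Exhaustive W = ∀ {χ} → All (λ w → literals w ⊩ χ) W → ⊢ χ

-- Case distinction on the first atom merges the two halves of the list, until no hypotheses remain.
states-exhaustive : ∀ as → Exhaustive (states as)
states-exhaustive []       (d ∷ []) = closed d
states-exhaustive (a ∷ as) ds       =
  states-exhaustive as (All.zipWith (uncurry literal-cases)
    (All.map⁻ (All.++⁻ˡ _ ds) , All.map⁻ (All.++⁻ʳ (map (true ∷_) (states as)) ds)))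

Refuted : ∀ {as} → State as → Set
Refuted w = literals w ⊩ falsum

-- A refuted state derives every formula by `ex-falso`, so dropping it loses no constraint.
exhaustive-trim : ∀ {as} {W V : List (State as)} → (∀ {w} → w ∈ W → w ∈ V ⊎ Refuted w) →
                  Exhaustive W → Exhaustive V
exhaustive-trim split exhaustive ds =
  exhaustive (All.tabulate ([ All.lookup ds , (λ d → mp d (ex-falso _)) ]′ ∘ split))

-- Searching and trimming lists.

all-or : ∀ {A : Set} {P : A → Set} {Q : Set} xs → (∀ {x} → x ∈ xs → P x ⊎ Q) → All P xs ⊎ Q
all-or []       h = inj₁ []
all-or (x ∷ xs) h with h (here refl) | all-or xs (h ∘ there)
... | inj₂ q | _       = inj₂ q
... | inj₁ _ | inj₂ q  = inj₂ q
... | inj₁ p | inj₁ ps = inj₁ (p ∷ ps)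

-- Only the first element for which the test returns `Q` is dropped.
all-or-trim : ∀ {A : Set} {P Q : A → Set} → (∀ x → P x ⊎ Q x) → ∀ xs →
              All P xs ⊎ (Σ[ ys ∈ List A ] length ys < length xs × (∀ {x} → x ∈ xs → x ∈ ys ⊎ Q x))
all-or-trim h [] = inj₁ []
all-or-trim h (x ∷ xs) with h x | all-or-trim h xs
... | inj₂ q | _       = inj₂ (xs , ℕ.≤-refl , λ { (here refl) → inj₂ q ; (there p) → inj₁ p })
... | inj₁ p | inj₁ ps = inj₁ (p ∷ ps)
... | inj₁ _ | inj₂ (ys , lt , f) =
  inj₂ (x ∷ ys , s≤s lt , λ { (here refl) → inj₁ (here refl) ; (there p) → Sum.map₁ there (f p) })

-- Extents and the finite Boolean algebra of subsets.

extent : ∀ {A : Set} (xs : List A) → (A → Bool) → Subset (length xs)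
extent xs f = Vec.map f (fromList xs)

extent-cong : ∀ {A : Set} {f g : A → Bool} {xs} → All (λ x → f x ≡ g x) xs → extent xs f ≡ extent xs g
extent-cong []       = refl
extent-cong (p ∷ ps) = cong₂ Vec._∷_ p (extent-cong ps)

extent-injective : ∀ {A : Set} {f g : A → Bool} xs → extent xs f ≡ extent xs g → All (λ x → f x ≡ g x) xs
extent-injective []       _  = []
extent-injective (x ∷ xs) eq = Vec.∷-injectiveˡ eq ∷ extent-injective xs (Vec.∷-injectiveʳ eq)

extent-zipWith : ∀ {A : Set} (_•_ : Bool → Bool → Bool) (f g : A → Bool) xs →
                 Vec.zipWith _•_ (extent xs f) (extent xs g) ≡ extent xs (λ x → f x • g x)
extent-zipWith _•_ f g []       = refl
extent-zipWith _•_ f g (x ∷ xs) = cong (_ Vec.∷_) (extent-zipWith _•_ f g xs)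

extent-const : ∀ {A : Set} {f : A → Bool} {b xs} → All (λ x → f x ≡ b) xs → extent xs f ≡ Vec.replicate _ b
extent-const {b = b} ps = trans (extent-cong ps) (Vec.map-const _ b)

_≟ₛ_ : ∀ {n} → DecidableEquality (Subset n)
_≟ₛ_ = Vec.≡-dec 𝔹._≟_

subset-finite : ∀ n → Subset n ↔ Fin (2 ^ n)
subset-finite zero    = ↔-trans (mk↔ₛ′ _ (const []) (λ _ → refl) (λ { [] → refl })) (↔-sym 1↔⊤)
subset-finite (suc n) =
  ↔-trans (mk↔ₛ′ (λ { (b ∷ X) → b , X }) (uncurry Vec._∷_) (λ _ → refl) (λ { (_ ∷ _) → refl }))
  (↔-trans (↔-sym 2↔Bool ×-↔ subset-finite n) (↔-sym *↔×))

infixr 5 _⇨_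

_⇨_ : ∀ {n} → Subset n → Subset n → Subset n
X ⇨ Y = ∁ X ∪ Y

⇨-⊥ : ∀ {n} (X : Subset n) → X ⇨ ⊥ ≡ ∁ X
⇨-⊥ X = ∪-identityʳ (∁ X)

-- The complement is the term `X ⇨ ⊥`, equal to `∁ X` but not by definition, so the complement laws
-- are carried along `⇨-⊥`.
⇨-isBooleanAlgebra : ∀ n → IsBooleanAlgebra _≡_ _∪_ _∩_ (λ X → X ⇨ ⊥) ⊤ (⊥ {n})
⇨-isBooleanAlgebra n = record
  { isDistributiveLattice = isDistributiveLattice
  ; ∨-complement = (λ X → trans (cong (_∪ X) (⇨-⊥ X)) (∨-complementˡ X))
                 , (λ X → trans (cong (X ∪_) (⇨-⊥ X)) (∨-complementʳ X))
  ; ∧-complement = (λ X → trans (cong (_∩ X) (⇨-⊥ X)) (∧-complementˡ X))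
                 , (λ X → trans (cong (X ∩_) (⇨-⊥ X)) (∧-complementʳ X))
  ; ¬-cong       = cong (_⇨ ⊥)
  }
  where
  open IsBooleanAlgebra (∪-∩-isBooleanAlgebra n)
    using (isDistributiveLattice; ∨-complementˡ; ∨-complementʳ; ∧-complementˡ; ∧-complementʳ)

-- Removal of refuted states.

module Filtration (φ : Formula) where

  World : Set
  World = State (atoms φ)

  truthSet : (W : List World) → Formula → Subset (length W)
  truthSet W α = extent W (holds α)

  Balanced : World → Formula → Set
  Balanced w α = ((holds α w 𝔹.∨ holds (∼ α) w) ≡ true) ×
                 (((holds α w 𝔹.∧ holds (∼ α) w) 𝔹.∧ holds (○ α) w) ≡ false)

  Congruent : List World → World → Formula → Formula → Set
  Congruent W w α β =
    truthSet W α ≡ truthSet W β → holds (∼ α) w ≡ holds (∼ β) w × holds (○ α) w ≡ holds (○ β) w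

  -- Both conditions are imposed at a single state, so that a failure can be blamed on that state.
  Good : List World → World → Set
  Good W w = All (λ α → Balanced w α × All (Congruent W w α) (arguments φ)) (arguments φ)

  argument-literals : ∀ {α} → α ∈ arguments φ → (w : World) →
    (literals w ⊩ literal α (holds α w)) ×
    (literals w ⊩ literal (∼ α) (holds (∼ α) w)) ×
    (literals w ⊩ literal (○ α) (holds (○ α) w))
  argument-literals {α} p w =
    holds-literal α (s ∘ there ∘ there) w , holds-literal (∼ α) s w , holds-literal (○ α) s w
    where
    s : atoms (∼ α) ⊆ atoms φ
    s = atoms-argument φ p

  -- Each listed state gives α and β the same literal and so derives the equivalence. Exhaustiveness
  -- makes it a theorem, as the replacement rules demand.
  equal-truthSets⇒⊢⇔ : ∀ {W α β} → Exhaustive W → α ∈ arguments φ → β ∈ arguments φ →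
                        truthSet W α ≡ truthSet W β → ⊢ α ⇔ β
  equal-truthSets⇒⊢⇔ {W} {α} exhaustive p q eq = exhaustive (All.map
    (λ {w} h → literal-⇔ (holds α w) (proj₁ (argument-literals p w))
      (subst (λ b → literals w ⊩ literal _ b) (sym h) (proj₁ (argument-literals q w))))
    (extent-injective W eq))

  congruent? : ∀ {W} → Exhaustive W → ∀ w {α β} → α ∈ arguments φ → β ∈ arguments φ →
               Congruent W w α β ⊎ Refuted w
  congruent? {W} exhaustive w {α} {β} p q with truthSet W α ≟ₛ truthSet W β
  ... | no neq = inj₁ λ eq → contradiction eq neq
  ... | yes eq with argument-literals p w | argument-literals q w
  ... | _ , α∼ , α○ | _ , β∼ , β○ with agree? _ _ (R∼ α⇔β) α∼ β∼ | agree? _ _ (R○ α⇔β) α○ β○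
    where α⇔β = equal-truthSets⇒⊢⇔ exhaustive p q eq
  ... | inj₁ e | inj₁ f = inj₁ λ _ → e , f
  ... | inj₁ _ | inj₂ d = inj₂ d
  ... | inj₂ d | _      = inj₂ d

  good? : ∀ {W} → Exhaustive W → ∀ w → Good W w ⊎ Refuted w
  good? exhaustive w = all-or (arguments φ) λ p →
    let d , e , f = argument-literals p w in
    [ (λ b → Sum.map₁ (b ,_) (all-or (arguments φ) (congruent? exhaustive w p))) , inj₂ ]′
      (balanced? _ _ _ d e f)

  -- `Good` depends on the whole list, so each removal calls for a fresh test; the falling length
  -- gives termination.
  saturate : ∀ W → Acc _<_ (length W) → Exhaustive W → ∃[ V ] Exhaustive V × All (Good V) V
  saturate W (acc rs) exhaustive with all-or-trim (good? exhaustive) W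
  ... | inj₁ good             = W , exhaustive , good
  ... | inj₂ (V , lt , split) = saturate V (rs lt) (exhaustive-trim split exhaustive)

  -- The BALFI of a saturated list.

  module Model (W : List World) (good : All (Good W) W) where

    Named : Subset (length W) → Set
    Named X = Any (λ α → truthSet W α ≡ X) (arguments φ)

    named? : ∀ X → Dec (Named X)
    named? X = any? (λ α → truthSet W α ≟ₛ X) (arguments φ)

    -- At a subset that is not a truth set of an argument, any values that
    -- satisfy the two BALFI laws will do.
    negAt circAt : ∀ {X} → Dec (Named X) → Subset (length W)
    negAt (yes p) = truthSet W (∼ proj₁ (find p))
    negAt (no _)  = ⊤
    circAt (yes p) = truthSet W (○ proj₁ (find p))
    circAt (no _)  = ⊥

    balanced : ∀ {α} → α ∈ arguments φ → All (λ w → Balanced w α) W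
    balanced p = All.map (λ g → proj₁ (All.lookup g p)) good

    -- Makes `negAt` and `circAt` independent of which argument `find` returns.
    congruent : ∀ {α β} → α ∈ arguments φ → β ∈ arguments φ → truthSet W α ≡ truthSet W β →
                truthSet W (∼ α) ≡ truthSet W (∼ β) × truthSet W (○ α) ≡ truthSet W (○ β)
    congruent p q eq = extent-cong (All.map proj₁ agree) , extent-cong (All.map proj₂ agree)
      where agree = All.map (λ g → All.lookup (proj₂ (All.lookup g p)) q eq) good

    -- Stated for any decision `d`, so that matching on it unfolds `negAt`; at a named set the law
    -- is `balanced`, read pointwise.
    negAt-em : ∀ {X} (d : Dec (Named X)) → X ∪ negAt d ≡ ⊤
    negAt-em (no _) = ∪-zeroʳ _
    negAt-em (yes p) with find p
    ... | α , q , refl = trans (extent-zipWith _ _ _ W) (extent-const (All.map proj₁ (balanced q)))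

    circAt-expl : ∀ {X} (d : Dec (Named X)) → (X ∩ negAt d) ∩ circAt d ≡ ⊥
    circAt-expl (no _) = ∩-zeroʳ _
    circAt-expl (yes p) with find p
    ... | α , q , refl = trans (cong (_∩ truthSet W (○ α)) (extent-zipWith _ _ _ W))
      (trans (extent-zipWith _ _ _ W) (extent-const (All.map proj₂ (balanced q))))

    algebra : BALFI
    algebra = record
      { Carrier          = Subset (length W)
      ; _⊓_              = _∩_
      ; _⊔_              = _∪_
      ; _⇨_              = _⇨_
      ; neg              = λ X → negAt (named? X)
      ; circ             = λ X → circAt (named? X)
      ; 0#               = ⊥
      ; 1#               = ⊤
      ; isBooleanAlgebra = ⇨-isBooleanAlgebra (length W)
      ; ⇨-def            = λ X Y → cong (_∪ Y) (sym (⇨-⊥ X))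
      ; neg-em           = λ X → negAt-em (named? X)
      ; circ-expl        = λ X → circAt-expl (named? X)
      }

    open BALFI algebra using (neg; circ)

    atTruthSet : ∀ {α} → α ∈ arguments φ → (d : Dec (Named (truthSet W α))) →
                     negAt d ≡ truthSet W (∼ α) × circAt d ≡ truthSet W (○ α)
    atTruthSet p (yes n) with find n
    ... | β , q , eq = congruent q p eq
    atTruthSet p (no ¬n) = contradiction (lose p refl) ¬n

    valuation : Formula → Subset (length W)
    valuation (var n) = truthSet W (var n)
    valuation (α ∧ β) = valuation α ∩ valuation β
    valuation (α ∨ β) = valuation α ∪ valuation β
    valuation (α ⇒ β) = valuation α ⇨ valuation β
    valuation (∼ α)   = neg (valuation α)
    valuation (○ α)   = circ (valuation α)

    isValuation : IsValuation algebra valuation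
    isValuation = record
      { ∧-homo = λ _ _ → refl
      ; ∨-homo = λ _ _ → refl
      ; ⇒-homo = λ _ _ → refl
      ; ∼-homo = λ _ → refl
      ; ○-homo = λ _ → refl
      }

    -- The truth lemma. The hypothesis on arguments passes to subformulas and puts each `neg` and
    -- `circ` within reach of `atTruthSet`.
    truth : ∀ α → arguments α ⊆ arguments φ → valuation α ≡ truthSet W α
    truth (var n) s = refl
    truth (α ∧ β) s = trans
      (cong₂ _∩_ (truth α (s ∘ xs⊆xs++ys _ _)) (truth β (s ∘ xs⊆ys++xs _ (arguments α))))
      (extent-zipWith _ _ _ W)
    truth (α ∨ β) s = trans
      (cong₂ _∪_ (truth α (s ∘ xs⊆xs++ys _ _)) (truth β (s ∘ xs⊆ys++xs _ (arguments α))))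
      (extent-zipWith _ _ _ W)
    truth (α ⇒ β) s = trans
      (cong₂ _⇨_ (truth α (s ∘ xs⊆xs++ys _ _)) (truth β (s ∘ xs⊆ys++xs _ (arguments α))))
      -- `∁` is `Vec.map not`, which fuses with the map that forms the extent.
      (trans (cong (_∪ truthSet W β) (sym (Vec.map-∘ not (holds α) (fromList W))))
        (extent-zipWith _ _ _ W))
    truth (∼ α) s = trans (cong neg (truth α (s ∘ there)))
      (proj₁ (atTruthSet (s (here refl)) (named? _)))
    truth (○ α) s = trans (cong circ (truth α (s ∘ there)))
      (proj₂ (atTruthSet (s (here refl)) (named? _)))

    -- By `truth`, value `⊤` means that φ holds at every listed state, so each of them derives φ.
    valid⇒⊢ : Exhaustive W → valuation φ ≡ ⊤ → ⊢ φ
    valid⇒⊢ exhaustive eq = exhaustive (All.map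
      (λ {w} h → subst (λ b → literals w ⊩ literal φ b) h (holds-literal φ id w))
      (extent-injective W (trans (sym (truth φ id)) (trans eq (sym (Vec.map-const (fromList W) true))))))

theorem4p2 : (φ : Formula) → ¬ (⊢ φ) →
    Σ[ A ∈ BALFI ] IsFinite A × (Σ[ v ∈ (Formula → BALFI.Carrier A) ] IsValuation A v × v φ ≢ BALFI.1# A)
theorem4p2 φ ⊬φ with Filtration.saturate φ (states (atoms φ)) (<-wellFounded _) (states-exhaustive (atoms φ))
... | W , exhaustive , good =
  algebra , (_ , subset-finite (length W)) , valuation , isValuation , ⊬φ ∘ valid⇒⊢ exhaustive
  where open Filtration.Model φ W good
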